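{- Let $G=(Q,E,\delta,q_0)$ be a deterministic automaton over a finite event set $E$ with uncontrollable events $E_{uc}\subseteq E$, let $d$ be a metric on $E$ with values in $[0,1]$, and let $\lambda\in[0,1]$. A language $K\subseteq L(G)$ is $\lambda$-controllable if and only if $d(B(K,\lambda)^{\uparrow},K)\leq\lambda$.
   Context: Setting. $E$ is a finite set of events, partitioned as $E=E_c\sqcup E_{uc}$ (controllable / uncontrollable events); $E^*$ is the set of finite strings over $E$ including the empty string $\epsilon$; $l(s)$ is the length of a string $s$; $\overline{L}$ is the prefix closure of a language $L\subseteq E^*$. $G=(Q,E,\delta,q_0)$ is a deterministic automaton with partial transition function $\delta:Q\times E\to Q$, extended to strings as usual, and $L(G)=\{s\in E^*:\delta(q_0,s)\text{ is defined}\}$ (a prefix closed language containing $\epsilon$). Metrics. $d$ is a metric on $E$ with values in $[0,1]$. Set $d(\epsilon,\epsilon)=0$ and $d(a,\epsilon)=d(\epsilon,a)=1$ for $a\in E$. For strings $s=s_1\cdots s_{l(s)}$, $t=t_1\cdots t_{l(t)}$, pad the shorter one with $\epsilon$'s and define $d(s,t)=\sum_{i=1}^{\max\{l(s),l(t)\}}2^{ -i}d(s_i,t_i)$. For a string $s$ and a language $A$, $d(s,A)=\inf_{a\in A}d(s,a)$ if $A\neq\emptyset$ and $d(s,\emptyset)=1$. For languages $A,B$, $d(A,B)$ is the Hausdorff metric: $d(\emptyset,\emptyset)=0$, and otherwise $d(A,B)=\max\{\sup_{a\in A}d(a,B),\sup_{b\in B}d(b,A)\}$ (a supremum over the empty set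 being $0$). Balls. For $s\in L(G)$, $B(s,\lambda)=\{t\in L(G):d(s,t)\le\lambda\}$, and for $K\subseteq L(G)$, $B(K,\lambda)=\bigcup_{s\in K}B(s,\lambda)$. Controllability. A language $K\subseteq L(G)$ is controllable if $\overline{K}E_{uc}\cap L(G)\subseteq\overline{K}$. $K^{\uparrow}$ denotes the supremal (largest) controllable sublanguage of $K$, i.e. the union of all controllable $M\subseteq K$. A language $K\subseteq L(G)$ is $\lambda$-controllable if there is a controllable language $\widetilde K\subseteq L(G)$ with $d(\widetilde K,K)\le\lambda$; such a $\widetilde K$ is called a realization of $K$. -}

module Defs where

open import Level using (0ℓ; Lift; lift; lower) renaming (suc to lsuc)
open import Algebra.Bundles using (CommutativeRing)
open import Algebra.Core using (Op₁; Op₂)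
open import Algebra.Structures using (IsCommutativeRing)
open import Axiom.ExcludedMiddle using (ExcludedMiddle)
open import Data.Fin.Base using (toℕ)
open import Data.List.Base using (List; []; _∷_; _++_; _∷ʳ_; length; head; drop)
open import Data.Maybe using (Maybe; just; nothing; Is-just; _>>=_)
open import Data.Nat.Base as ℕ using (ℕ)
open import Data.Product.Base using (∃; ∃-syntax; _×_; _,_; proj₁)
open import Function.Metric.Structures using (IsGeneralMetric)
open import Relation.Binary.Bundles using (TotalOrder)
open import Relation.Binary.Core using (Rel)
open import Relation.Binary.PropositionalEquality using (_≡_)
open import Relation.Binary.Structures using (IsTotalOrder)
open import Relation.Nullary.Decidable using (yes; no; map′; True)
open import Relation.Nullary.Negation using (¬_)
open import Relation.Unary using (Pred; _∈_; _⊆_; Satisfiable)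

import Algebra.Construct.NaturalChoice.Max as NaturalMax
import Algebra.Properties.Semiring.Exp as Exp
import Algebra.Properties.Semiring.Sum as Sum

module _ {A : Set} (_≤_ : Rel A 0ℓ) where

  IsUpperBound IsLowerBound IsLUB IsGLB : Pred A 0ℓ → Pred A 0ℓ
  IsUpperBound P u = ∀ {x} → x ∈ P → x ≤ u
  IsLowerBound P l = ∀ {x} → x ∈ P → l ≤ x
  IsLUB P u = IsUpperBound P u × (∀ {v} → IsUpperBound P v → u ≤ v)
  IsGLB P l = IsLowerBound P l × (∀ {m} → IsLowerBound P m → m ≤ l)

-- The real numbers, axiomatised (up to isomorphism) as a Dedekind complete
-- ordered field.  The inverse is total, with an unspecified value at zero.
record CompleteOrderedField : Set₁ where
  infixl 7 _*_
  infixl 6 _+_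
  infix  4 _≈_ _≤_
  field
    Carrier           : Set
    _≈_ _≤_           : Rel Carrier 0ℓ
    _+_ _*_           : Op₂ Carrier
    -_ _⁻¹            : Op₁ Carrier
    0# 1#             : Carrier
    isCommutativeRing : IsCommutativeRing _≈_ _+_ _*_ -_ 0# 1#
    0≉1               : ¬ (0# ≈ 1#)
    ⁻¹-inverse        : ∀ x → ¬ (x ≈ 0#) → x * x ⁻¹ ≈ 1#
    isTotalOrder      : IsTotalOrder _≈_ _≤_
    +-monoʳ-≤         : ∀ x {y z} → y ≤ z → x + y ≤ x + z
    *-nonNeg          : ∀ {x y} → 0# ≤ x → 0# ≤ y → 0# ≤ x * y
    complete          : (P : Pred Carrier 0ℓ) → Satisfiable P →
                        ∃ (IsUpperBound _≤_ P) → ∃ (IsLUB _≤_ P)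

  commutativeRing : CommutativeRing 0ℓ 0ℓ
  commutativeRing = record { isCommutativeRing = isCommutativeRing }

  totalOrder : TotalOrder 0ℓ 0ℓ 0ℓ
  totalOrder = record { isTotalOrder = isTotalOrder }

  open CommutativeRing commutativeRing public using (semiring)
  open NaturalMax totalOrder public using (_⊔_)
  open Exp semiring public using (_^_)
  open Sum semiring public using (sum-syntax)

  ½ : Carrier
  ½ = (1# + 1#) ⁻¹

  glb : (P : Pred Carrier 0ℓ) → Satisfiable P →
        ∃ (IsLowerBound _≤_ P) → ∃ (IsGLB _≤_ P)
  glb P (p , p∈P) bounded
    with complete (IsLowerBound _≤_ P) bounded (p , λ l → l p∈P)
  ... | g , upper , least = g , (λ x∈P → least (λ l → l x∈P)) , upper

-- Every letter-to-letter distance lies in [0,1].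
record UnitMetric (ℝ : CompleteOrderedField) (E : Set) : Set where
  open CompleteOrderedField ℝ
  field
    dist     : E → E → Carrier
    isMetric : IsGeneralMetric _≡_ _≈_ _≤_ 0# _+_ dist
    dist≤1   : ∀ a b → dist a b ≤ 1#

Language : Set → Set₁
Language E = Pred (List E) 0ℓ

record Automaton (E : Set) : Set₁ where
  field
    Q  : Set
    δ  : Q → E → Maybe Q
    q₀ : Q

  δ* : Q → List E → Maybe Q
  δ* q []      = just q
  δ* q (a ∷ s) = δ q a >>= λ q′ → δ* q′ s

L : ∀ {E} → Automaton E → Language E
L G s = Is-just (δ* q₀ s)
  where open Automaton G

closure : ∀ {E} → Language E → Language E
closure K s = ∃[ t ] (s ++ t) ∈ K

record Controllable {E : Set} (Euc : Pred E 0ℓ) (G : Automaton E)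
                    (K : Language E) : Set where
  field
    K⊆L    : K ⊆ L G
    closed : ∀ {s a} → s ∈ closure K → a ∈ Euc →
             (s ∷ʳ a) ∈ L G → (s ∷ʳ a) ∈ closure K

-- Excluded middle is assumed because the distances below are real-valued
-- functions of arbitrary languages; their values are suprema and infima of
-- arbitrary sets and depend on whether a language is empty.
module Classical (em : ExcludedMiddle (lsuc 0ℓ)) where

  em₀ : ExcludedMiddle 0ℓ
  em₀ {P} = map′ lower lift (em {P = Lift (lsuc 0ℓ) P})

  -- The union of all controllable M ⊆ K.  The union is indexed by languages,
  -- so membership is a proposition in Set₁; True ∘ em is an equivalent one
  -- in Set, which makes the union a Language again.
  supremal : ∀ {E} → Pred E 0ℓ → Automaton E → Language E → Language E
  supremal Euc G K s =
    True (em {P = ∃[ M ] Controllable Euc G M × M ⊆ K × s ∈ M})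

  module Distance (ℝ : CompleteOrderedField) {E : Set}
                  (metric : UnitMetric ℝ E) where
    open CompleteOrderedField ℝ
    open UnitMetric metric

    -- sup ∅ = 0 is part of the definition of the Hausdorff distance.  The
    -- value 0 on unbounded sets, and on the empty set for inf, is never used:
    -- all sets below are contained in [0,1], and inf is applied to
    -- nonempty ones only.
    sup inf : Pred Carrier 0ℓ → Carrier
    sup P with em₀ {P = Satisfiable P × ∃ (IsUpperBound _≤_ P)}
    ... | yes (nonempty , bounded) = proj₁ (complete P nonempty bounded)
    ... | no  _                    = 0#
    inf P with em₀ {P = Satisfiable P × ∃ (IsLowerBound _≤_ P)}
    ... | yes (nonempty , bounded) = proj₁ (glb P nonempty bounded)
    ... | no  _                    = 0#

    image : (List E → Carrier) → Language E → Pred Carrier 0ℓ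
    image f A x = ∃[ a ] a ∈ A × x ≈ f a

    -- nothing plays the role of ε.
    dₑ : Maybe E → Maybe E → Carrier
    dₑ (just a) (just b) = dist a b
    dₑ nothing  nothing  = 0#
    dₑ (just _) nothing  = 1#
    dₑ nothing  (just _) = 1#

    -- The letter at a position counted from 0, after padding with ε.
    letter : List E → ℕ → Maybe E
    letter s i = head (drop i s)

    -- Positions start from 0 here, hence the exponent i + 1.
    dₛ : List E → List E → Carrier
    dₛ s t = ∑[ i < length s ℕ.⊔ length t ]
               (½ ^ ℕ.suc (toℕ i) * dₑ (letter s (toℕ i)) (letter t (toℕ i)))

    dₚ : List E → Language E → Carrier
    dₚ s A with em₀ {P = Satisfiable A}
    ... | yes _ = inf (image (dₛ s) A)
    ... | no  _ = 1#

    -- Since sup ∅ = 0, this also gives distance 0 between empty languages.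
    dₕ : Language E → Language E → Carrier
    dₕ A B = sup (image (λ a → dₚ a B) A) ⊔ sup (image (λ b → dₚ b A) B)

    ball : Automaton E → List E → Carrier → Language E
    ball G s r t = t ∈ L G × dₛ s t ≤ r

    B : Automaton E → Language E → Carrier → Language E
    B G K r t = ∃[ s ] s ∈ K × t ∈ ball G s r

    λ-Controllable : Pred E 0ℓ → Automaton E → Carrier → Language E → Set₁
    λ-Controllable Euc G r K =
      ∃[ K̃ ] Controllable Euc G K̃ × dₕ K̃ K ≤ r

{-# OPTIONS --safe #-}

-- A realization K̃ of K should lie in B(K,r); being controllable, it then lies
-- in B(K,r)↑, which is in turn within r of K by construction of the ball.  The
-- ball is closed, so K̃ ⊆ B(K,r) requires that the infimum defining d(s,K) is
-- attained, although K may be infinite: beyond position l(s) only the length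
-- of t matters for d(s,t), and d(s,t) increases with it, so a minimiser is
-- found among finitely many classes of strings (E is finite).  Once r ≥ 1
-- both sides hold because all distances are at most 1; for r < 1 the value
-- d(s,∅) = 1 never interferes.
module Submission where

open import Defs
open import Level using (0ℓ) renaming (suc to lsuc)
open import Axiom.ExcludedMiddle using (ExcludedMiddle)
open import Data.Empty using (⊥-elim)
open import Data.Fin.Base using (Fin; zero; suc; toℕ)
open import Data.List.Base using (List; []; _∷_; length; head; drop)
open import Data.Maybe.Base using (Maybe; just; nothing)
open import Data.Nat.Base as ℕ using (ℕ; s≤s)
open import Data.Nat.Induction using (<-wellFounded)
open import Data.Product.Base using (∃; ∃-syntax; _×_; _,_; proj₁; proj₂)
open import Data.Sum.Base using (inj₁; inj₂)
open import Function.Bundles using (_⇔_; _↔_; mk⇔; Inverse)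
open import Function.Metric.Structures using (IsGeneralMetric)
open import Induction.WellFounded using (Acc; acc)
open import Relation.Binary.Bundles using (TotalOrder)
open import Relation.Binary.PropositionalEquality as ≡ using (_≡_)
open import Relation.Nullary.Decidable using (yes; no; toWitness; fromWitness)
open import Relation.Nullary.Negation using (¬_; contradiction)
open import Relation.Unary using (Pred; _∈_; _⊆_; _∪_; _≐_; ⋃; Satisfiable)

import Algebra.Bundles as Bundles
import Algebra.Properties.Ring as RingProperties
import Algebra.Properties.Semiring.Sum as Sum
import Algebra.Construct.NaturalChoice.Max as NaturalMax
import Data.Nat.Properties as ℕₚ
import Relation.Binary.Construct.On as On
import Relation.Binary.Reasoning.PartialOrder as PosetReasoning

-- Ordered field arithmetic and dyadic sums.

module OrderedField (ℝ : CompleteOrderedField) where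
  open CompleteOrderedField ℝ
  open TotalOrder totalOrder public
    using (poset; total; antisym; module Eq)
    renaming (refl to ≤-refl; trans to ≤-trans; reflexive to ≤-reflexive)
  open Bundles.CommutativeRing commutativeRing public
    using ( ring; +-comm; +-assoc; +-cong; +-congˡ; +-congʳ; +-identityˡ; +-identityʳ
          ; -‿inverseˡ; -‿inverseʳ; *-assoc; *-comm; *-congˡ; *-congʳ
          ; *-identityʳ; distribˡ; zeroʳ)
  open RingProperties ring using (-1*x≈-x; -‿involutive)
  open NaturalMax totalOrder public using (⊔-lub; x≤x⊔y; x≤y⊔x)
  open PosetReasoning poset

  +-monoˡ-≤ : ∀ z {x y} → x ≤ y → x + z ≤ y + z
  +-monoˡ-≤ z {x} {y} x≤y = begin
    x + z ≈⟨ +-comm x z ⟩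
    z + x ≤⟨ +-monoʳ-≤ z x≤y ⟩
    z + y ≈⟨ +-comm z y ⟩
    y + z ∎

  +-mono-≤ : ∀ {x y u v} → x ≤ y → u ≤ v → x + u ≤ y + v
  +-mono-≤ {y = y} {u} x≤y u≤v = ≤-trans (+-monoˡ-≤ u x≤y) (+-monoʳ-≤ y u≤v)

  x≤y⇒0≤-x+y : ∀ {x y} → x ≤ y → 0# ≤ - x + y
  x≤y⇒0≤-x+y {x} {y} x≤y = begin
    0#      ≈⟨ -‿inverseˡ x ⟨
    - x + x ≤⟨ +-monoʳ-≤ (- x) x≤y ⟩
    - x + y ∎

  *-monoʳ-≤ : ∀ {a} → 0# ≤ a → ∀ {x y} → x ≤ y → a * x ≤ a * y
  *-monoʳ-≤ {a} 0≤a {x} {y} x≤y = begin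
    a * x                   ≈⟨ +-identityʳ _ ⟨
    a * x + 0#              ≤⟨ +-monoʳ-≤ _ (*-nonNeg 0≤a (x≤y⇒0≤-x+y x≤y)) ⟩
    a * x + a * (- x + y)   ≈⟨ distribˡ a x (- x + y) ⟨
    a * (x + (- x + y))     ≈⟨ *-congˡ (+-assoc x (- x) y) ⟨
    a * (x + - x + y)       ≈⟨ *-congˡ (+-congʳ (-‿inverseʳ x)) ⟩
    a * (0# + y)            ≈⟨ *-congˡ (+-identityˡ y) ⟩
    a * y                   ∎

  0≤1 : 0# ≤ 1#
  0≤1 with total 0# 1#
  ... | inj₁ 0≤1 = 0≤1
  ... | inj₂ 1≤0 = begin
    0#            ≤⟨ *-nonNeg 0≤-1 0≤-1 ⟩
    - 1# * - 1#   ≈⟨ -1*x≈-x (- 1#) ⟩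
    - - 1#        ≈⟨ -‿involutive 1# ⟩
    1#            ∎
    where
    0≤-1 : 0# ≤ - 1#
    0≤-1 = begin
      0#         ≤⟨ x≤y⇒0≤-x+y 1≤0 ⟩
      - 1# + 0#  ≈⟨ +-identityʳ _ ⟩
      - 1#       ∎

  1≰0 : ¬ (1# ≤ 0#)
  1≰0 1≤0 = 0≉1 (antisym 0≤1 1≤0)

  2≉0 : ¬ (1# + 1# ≈ 0#)
  2≉0 2≈0 = 1≰0 (begin
    1#       ≈⟨ +-identityʳ 1# ⟨
    1# + 0#  ≤⟨ +-monoʳ-≤ 1# 0≤1 ⟩
    1# + 1#  ≈⟨ 2≈0 ⟩
    0#       ∎)

  ½*2≈1 : ½ * (1# + 1#) ≈ 1#
  ½*2≈1 = Eq.trans (*-comm ½ (1# + 1#)) (⁻¹-inverse (1# + 1#) 2≉0)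

  -- The axioms say nothing about the sign of an inverse; but `½ ≤ 0#` would give 1 = ½ + ½ ≤ 0.
  0≤½ : 0# ≤ ½
  0≤½ with total 0# ½
  ... | inj₁ 0≤½ = 0≤½
  ... | inj₂ ½≤0 = ⊥-elim (1≰0 (begin
    1#               ≈⟨ ½*2≈1 ⟨
    ½ * (1# + 1#)    ≈⟨ distribˡ ½ 1# 1# ⟩
    ½ * 1# + ½ * 1#  ≈⟨ +-cong (*-identityʳ ½) (*-identityʳ ½) ⟩
    ½ + ½            ≤⟨ +-mono-≤ ½≤0 ½≤0 ⟩
    0# + 0#          ≈⟨ +-identityˡ 0# ⟩
    0#               ∎))

  ½*-mono-≤ : ∀ {x y} → x ≤ y → ½ * x ≤ ½ * y
  ½*-mono-≤ = *-monoʳ-≤ 0≤½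

  open Sum semiring using (sum-cong-≋; *-distribˡ-sum)

  -- Splits off the first term and takes a factor ½ out of the rest. The shifted sequence `e′` is a
  -- separate argument because the letters of a tail agree with the shifted letters only up to a
  -- proof.
  dyadicSum-suc : ∀ n (e e′ : ℕ → Carrier) → (∀ i → e (ℕ.suc i) ≈ e′ i) →
    ∑[ i < ℕ.suc n ] (½ ^ ℕ.suc (toℕ i) * e (toℕ i)) ≈
    ½ * (e 0 + ∑[ i < n ] (½ ^ ℕ.suc (toℕ i) * e′ (toℕ i)))
  dyadicSum-suc n e e′ shift = Eq.trans
    (+-cong (*-congʳ (*-identityʳ ½))
      (Eq.trans
        (sum-cong-≋ {n} (λ i → Eq.trans (*-congˡ (shift (toℕ i)))
                                        (*-assoc ½ (½ ^ ℕ.suc (toℕ i)) (e′ (toℕ i)))))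
        (Eq.sym (*-distribˡ-sum {n} ½ _))))
    (Eq.sym (distribˡ ½ _ _))

-- Attained minima over finite unions, and shortest strings.

module Minima (em : ExcludedMiddle (lsuc 0ℓ)) (ℝ : CompleteOrderedField) where
  open CompleteOrderedField ℝ
  open Classical em
  open OrderedField ℝ

  -- Vacuous for empty `P`, so that a set may be cut into finitely many pieces without asking which
  -- of them are inhabited.
  HasMinimum : {X : Set} → (X → Carrier) → Pred X 0ℓ → Set
  HasMinimum f P = Satisfiable P → ∃[ a ] a ∈ P × (∀ {b} → b ∈ P → f a ≤ f b)

  module _ {X : Set} {f : X → Carrier} where

    HasMinimum-resp-≐ : ∀ {P Q} → P ≐ Q → HasMinimum f P → HasMinimum f Q
    HasMinimum-resp-≐ (P⊆Q , Q⊆P) min (x , x∈Q) with min (x , Q⊆P x∈Q)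
    ... | a , a∈P , a-min = a , P⊆Q a∈P , λ b∈Q → a-min (Q⊆P b∈Q)

    HasMinimum-∪ : ∀ {P Q} → HasMinimum f P → HasMinimum f Q → HasMinimum f (P ∪ Q)
    HasMinimum-∪ {P} {Q} minP minQ (x , x∈P∪Q)
      -- The minimum of either set is available only once that set is known to be nonempty.
      with em₀ {P = Satisfiable P} | em₀ {P = Satisfiable Q}
    ... | no ¬P | no ¬Q = contradiction x∈P∪Q λ where
      (inj₁ x∈P) → ¬P (x , x∈P)
      (inj₂ x∈Q) → ¬Q (x , x∈Q)
    ... | yes p | no ¬Q with minP p
    ...   | a , a∈P , a-min = a , inj₁ a∈P , λ where
      (inj₁ b∈P) → a-min b∈P
      (inj₂ b∈Q) → contradiction (_ , b∈Q) ¬Q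
    HasMinimum-∪ minP minQ _ | no ¬P | yes q with minQ q
    ... | a , a∈Q , a-min = a , inj₂ a∈Q , λ where
      (inj₁ b∈P) → contradiction (_ , b∈P) ¬P
      (inj₂ b∈Q) → a-min b∈Q
    HasMinimum-∪ minP minQ _ | yes p | yes q with minP p | minQ q
    ... | a , a∈P , a-min | b , b∈Q , b-min with total (f a) (f b)
    ...   | inj₁ fa≤fb = a , inj₁ a∈P , λ where
      (inj₁ c∈P) → a-min c∈P
      (inj₂ c∈Q) → ≤-trans fa≤fb (b-min c∈Q)
    ...   | inj₂ fb≤fa = b , inj₂ b∈Q , λ where
      (inj₁ c∈P) → ≤-trans fb≤fa (a-min c∈P)
      (inj₂ c∈Q) → b-min c∈Q

    HasMinimum-⋃ : ∀ n (P : Fin n → Pred X 0ℓ) →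
                   (∀ i → HasMinimum f (P i)) → HasMinimum f (⋃ (Fin n) P)
    HasMinimum-⋃ ℕ.zero    P min (_ , () , _)
    HasMinimum-⋃ (ℕ.suc n) P min = HasMinimum-resp-≐
      ( (λ { (inj₁ x∈P) → zero , x∈P ; (inj₂ (i , x∈P)) → suc i , x∈P })
      , (λ { (zero , x∈P) → inj₁ x∈P ; (suc i , x∈P) → inj₂ (i , x∈P) }))
      (HasMinimum-∪ (min zero) (HasMinimum-⋃ n (λ i → P (suc i)) (λ i → min (suc i))))

  -- Descent along the well-founded order on lengths; excluded middle decides whether a shorter
  -- member exists.
  shortest : ∀ {E : Set} (A : Language E) → Satisfiable A →
             ∃[ a ] a ∈ A × (∀ {b} → b ∈ A → length a ℕ.≤ length b)
  shortest {E} A (x , x∈A) = go x (On.wellFounded length <-wellFounded x) x∈A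
    where
    go : ∀ a → Acc (λ s t → length s ℕ.< length t) a → a ∈ A →
         ∃[ a ] a ∈ A × (∀ {b} → b ∈ A → length a ℕ.≤ length b)
    go a (acc rec) a∈A with em₀ {P = ∃[ b ] b ∈ A × length b ℕ.< length a}
    ... | yes (b , b∈A , b<a) = go b (rec b<a) b∈A
    ... | no  none = a , a∈A , λ b∈A → ℕₚ.≮⇒≥ (λ b<a → none (_ , b∈A , b<a))

-- Distance between strings.

module Distances (em : ExcludedMiddle (lsuc 0ℓ)) (ℝ : CompleteOrderedField)
                 {E : Set} (metric : UnitMetric ℝ E) where
  open CompleteOrderedField ℝ
  open Classical em
  open OrderedField ℝ
  open Minima em ℝ
  open UnitMetric metric
  open Distance ℝ metric
  open PosetReasoning poset

  0≤dₑ : ∀ a b → 0# ≤ dₑ a b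
  0≤dₑ (just a) (just b) = IsGeneralMetric.nonNegative isMetric
  0≤dₑ (just _) nothing  = 0≤1
  0≤dₑ nothing  (just _) = 0≤1
  0≤dₑ nothing  nothing  = ≤-refl

  dₑ≤1 : ∀ a b → dₑ a b ≤ 1#
  dₑ≤1 (just a) (just b) = dist≤1 a b
  dₑ≤1 (just _) nothing  = ≤-refl
  dₑ≤1 nothing  (just _) = ≤-refl
  dₑ≤1 nothing  nothing  = 0≤1

  dₑ-sym : ∀ a b → dₑ a b ≈ dₑ b a
  dₑ-sym (just a) (just b) = IsGeneralMetric.sym isMetric a b
  dₑ-sym (just _) nothing  = Eq.refl
  dₑ-sym nothing  (just _) = Eq.refl
  dₑ-sym nothing  nothing  = Eq.refl

  letter-suc : ∀ s i → letter s (ℕ.suc i) ≡ letter (drop 1 s) i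
  letter-suc []      ℕ.zero    = ≡.refl
  letter-suc []      (ℕ.suc _) = ≡.refl
  letter-suc (_ ∷ _) _         = ≡.refl

  dyadicSum-drop : ∀ n s t →
    ∑[ i < ℕ.suc n ] (½ ^ ℕ.suc (toℕ i) * dₑ (letter s (toℕ i)) (letter t (toℕ i))) ≈
    ½ * (dₑ (head s) (head t) + ∑[ i < n ]
      (½ ^ ℕ.suc (toℕ i) * dₑ (letter (drop 1 s) (toℕ i)) (letter (drop 1 t) (toℕ i))))
  dyadicSum-drop n s t = dyadicSum-suc n (λ i → dₑ (letter s i) (letter t i)) _
    (λ i → Eq.reflexive (≡.cong₂ dₑ (letter-suc s i) (letter-suc t i)))

  -- This recursion stands in for the sum in all that follows. Since `drop 1 []` is `[]` and
  -- `head []` is `nothing`, padding needs no separate treatment; for two empty strings it reads 0 =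
  -- ½(0 + 0).
  dₛ-step : ∀ s t →
    dₛ s t ≈ ½ * (dₑ (head s) (head t) + dₛ (drop 1 s) (drop 1 t))
  dₛ-step []                 []         = Eq.sym (Eq.trans (*-congˡ (+-identityˡ 0#)) (zeroʳ ½))
  dₛ-step s@(_ ∷ s′)         t@(_ ∷ t′) = dyadicSum-drop (length s′ ℕ.⊔ length t′) s t
  -- The tail is split because the number of terms on the right, `length s′ ⊔ 0`, computes only when
  -- the form of `s′` is known.
  dₛ-step s@(_ ∷ [])         []         = dyadicSum-drop 0 s []
  dₛ-step s@(_ ∷ s′@(_ ∷ _)) []         = dyadicSum-drop (length s′) s []
  dₛ-step []                 t@(_ ∷ t′) = dyadicSum-drop (length t′) [] t

  -- The induction that fits `dₛ-step`: both strings lose their first letter at once, and an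
  -- exhausted one stays empty.
  drop-induction : (P : List E → List E → Set) → P [] [] →
                   (∀ {s t} → P (drop 1 s) (drop 1 t) → P s t) → ∀ s t → P s t
  drop-induction P base step []      []      = base
  drop-induction P base step []      (_ ∷ t) = step (drop-induction P base step [] t)
  drop-induction P base step (_ ∷ s) []      = step (drop-induction P base step s [])
  drop-induction P base step (_ ∷ s) (_ ∷ t) = step (drop-induction P base step s t)

  0≤dₛ : ∀ s t → 0# ≤ dₛ s t
  0≤dₛ = drop-induction (λ s t → 0# ≤ dₛ s t) ≤-refl λ {s} {t} 0≤d → begin
    0#                                                     ≈⟨ zeroʳ ½ ⟨
    ½ * 0#                                                 ≈⟨ *-congˡ (+-identityˡ 0#) ⟨
    ½ * (0# + 0#)
      ≤⟨ ½*-mono-≤ (+-mono-≤ (0≤dₑ (head s) (head t)) 0≤d) ⟩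
    ½ * (dₑ (head s) (head t) + dₛ (drop 1 s) (drop 1 t))  ≈⟨ dₛ-step s t ⟨
    dₛ s t                                                 ∎

  -- The bound reproduces itself under the recursion, as ½(1 + 1) = 1.
  dₛ≤1 : ∀ s t → dₛ s t ≤ 1#
  dₛ≤1 = drop-induction (λ s t → dₛ s t ≤ 1#) 0≤1 λ {s} {t} d≤1 → begin
    dₛ s t                                                 ≈⟨ dₛ-step s t ⟩
    ½ * (dₑ (head s) (head t) + dₛ (drop 1 s) (drop 1 t))
      ≤⟨ ½*-mono-≤ (+-mono-≤ (dₑ≤1 (head s) (head t)) d≤1) ⟩
    ½ * (1# + 1#)                                          ≈⟨ ½*2≈1 ⟩
    1#                                                     ∎

  dₛ-sym : ∀ s t → dₛ s t ≈ dₛ t s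
  dₛ-sym = drop-induction (λ s t → dₛ s t ≈ dₛ t s) Eq.refl λ {s} {t} d-sym →
    Eq.trans (dₛ-step s t)
      (Eq.trans (*-congˡ (+-cong (dₑ-sym (head s) (head t)) d-sym))
                (Eq.sym (dₛ-step t s)))

  dₛ-mono-drop : ∀ s {t u} → head t ≡ head u →
                 dₛ (drop 1 s) (drop 1 t) ≤ dₛ (drop 1 s) (drop 1 u) → dₛ s t ≤ dₛ s u
  dₛ-mono-drop s {t} {u} same d≤d = begin
    dₛ s t                                                 ≈⟨ dₛ-step s t ⟩
    ½ * (dₑ (head s) (head t) + dₛ (drop 1 s) (drop 1 t))  ≤⟨ ½*-mono-≤ (+-mono-≤ dₑ≤dₑ d≤d) ⟩
    ½ * (dₑ (head s) (head u) + dₛ (drop 1 s) (drop 1 u))  ≈⟨ dₛ-step s u ⟨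
    dₛ s u                                                 ∎
    where
    dₑ≤dₑ : dₑ (head s) (head t) ≤ dₑ (head s) (head u)
    dₑ≤dₑ = ≤-reflexive (Eq.reflexive (≡.cong (dₑ (head s)) same))

  -- Every letter is at distance 1 from ε, so only the number of letters counts.
  dₛ[]-mono-length : ∀ t u → length t ℕ.≤ length u → dₛ [] t ≤ dₛ [] u
  dₛ[]-mono-length []      u       _         = 0≤dₛ [] u
  dₛ[]-mono-length (x ∷ t) (y ∷ u) (s≤s t≤u) = begin
    dₛ [] (x ∷ t)       ≈⟨ dₛ-step [] (x ∷ t) ⟩
    ½ * (1# + dₛ [] t)  ≤⟨ ½*-mono-≤ (+-monoʳ-≤ 1# (dₛ[]-mono-length t u t≤u)) ⟩
    ½ * (1# + dₛ [] u)  ≈⟨ dₛ-step [] (y ∷ u) ⟨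
    dₛ [] (y ∷ u)       ∎

  -- Attainment of the distance from a string to a language.

  module _ {n : ℕ} (E↔Fin : E ↔ Fin n) where
    open Inverse E↔Fin using (to; from; strictlyInverseʳ)

    -- Enumerates the possible values of `head`; index `zero` is that of the empty string.
    initial : Fin (ℕ.suc n) → Maybe E
    initial zero    = nothing
    initial (suc i) = just (from i)

    initial-surjective : ∀ m → ∃[ i ] m ≡ initial i
    initial-surjective nothing  = zero , ≡.refl
    initial-surjective (just a) = suc (to a) , ≡.cong just (≡.sym (strictlyInverseʳ a))

    -- Induction on `s`. Against `[]` a shortest member is nearest. Otherwise `A` is cut into
    -- `n + 1` classes by first letter; within a class the first term is constant, so a nearest tail
    -- decides.
    dₛ-hasMinimum : ∀ s A → HasMinimum (dₛ s) A
    dₛ-hasMinimum [] A nonempty with shortest A nonempty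
    ... | a , a∈A , a-min = a , a∈A , λ {b} b∈A → dₛ[]-mono-length a b (a-min b∈A)
    dₛ-hasMinimum (x ∷ s) A = HasMinimum-resp-≐
      ( (λ (_ , t∈A , _) → t∈A)
      , (λ {t} t∈A → let i , eq = initial-surjective (head t) in i , t∈A , eq))
      (HasMinimum-⋃ (ℕ.suc n) startingWith startingWith-hasMinimum)
      where
      startingWith : Fin (ℕ.suc n) → Language E
      startingWith i t = t ∈ A × head t ≡ initial i

      startingWith-hasMinimum : ∀ i → HasMinimum (dₛ (x ∷ s)) (startingWith i)
      startingWith-hasMinimum i (t , t∈)
        -- The induction hypothesis is applied to the language of tails of the class; membership of
        -- the minimiser carries a string `a` of the class with that tail.
        with dₛ-hasMinimum s (λ u → ∃[ t ] t ∈ startingWith i × u ≡ drop 1 t)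
                           (drop 1 t , t , t∈ , ≡.refl)
      ... | _ , (a , a∈@(_ , eq) , ≡.refl) , a-min = a , a∈ , λ {b} b∈@(_ , eq′) →
        dₛ-mono-drop (x ∷ s) {a} {b} (≡.trans eq (≡.sym eq′)) (a-min (b , b∈ , ≡.refl))

  -- Suprema, infima and the distances to and between languages.

  sup-upper : ∀ {P u x} → IsUpperBound _≤_ P u → x ∈ P → x ≤ sup P
  sup-upper {P} {u} {x} P≤u x∈P
    with em₀ {P = Satisfiable P × ∃ (IsUpperBound _≤_ P)}
  ... | yes (nonempty , bounded) = proj₁ (proj₂ (complete P nonempty bounded)) x∈P
  ... | no  ¬hyp                 = ⊥-elim (¬hyp ((x , x∈P) , u , P≤u))

  -- The assumption `0# ≤ u` covers the case where `sup` takes its default value 0, in particular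
  -- the empty set.
  sup-least : ∀ {P u} → 0# ≤ u → IsUpperBound _≤_ P u → sup P ≤ u
  sup-least {P} 0≤u P≤u
    with em₀ {P = Satisfiable P × ∃ (IsUpperBound _≤_ P)}
  ... | yes (nonempty , bounded) = proj₂ (proj₂ (complete P nonempty bounded)) (λ x∈P → P≤u x∈P)
  ... | no  _                    = 0≤u

  inf-lower : ∀ {P l x} → IsLowerBound _≤_ P l → x ∈ P → inf P ≤ x
  inf-lower {P} {l} {x} l≤P x∈P
    with em₀ {P = Satisfiable P × ∃ (IsLowerBound _≤_ P)}
  ... | yes (nonempty , bounded) = proj₁ (proj₂ (glb P nonempty bounded)) x∈P
  ... | no  ¬hyp                 = ⊥-elim (¬hyp ((x , x∈P) , l , l≤P))

  inf-greatest : ∀ {P l} → Satisfiable P → IsLowerBound _≤_ P l → l ≤ inf P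
  inf-greatest {P} {l} nonempty l≤P
    with em₀ {P = Satisfiable P × ∃ (IsLowerBound _≤_ P)}
  ... | yes (nonempty , bounded) = proj₂ (proj₂ (glb P nonempty bounded)) (λ x∈P → l≤P x∈P)
  ... | no  ¬hyp                 = ⊥-elim (¬hyp (nonempty , l , l≤P))

  inf-dₛ≤dₛ : ∀ s {A a} → a ∈ A → inf (image (dₛ s) A) ≤ dₛ s a
  inf-dₛ≤dₛ s a∈A = inf-lower {l = 0#}
    (λ (b , _ , x≈d) → ≤-trans (0≤dₛ s b) (≤-reflexive (Eq.sym x≈d)))
    (_ , a∈A , Eq.refl)

  dₚ≤dₛ : ∀ s {A a} → a ∈ A → dₚ s A ≤ dₛ s a
  dₚ≤dₛ s {A} {a} a∈A with em₀ {P = Satisfiable A}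
  ... | yes _        = inf-dₛ≤dₛ s a∈A
  ... | no ¬nonempty = contradiction (a , a∈A) ¬nonempty

  dₚ≤1 : ∀ s A → dₚ s A ≤ 1#
  dₚ≤1 s A with em₀ {P = Satisfiable A}
  ... | yes (a , a∈A) = ≤-trans (inf-dₛ≤dₛ s a∈A) (dₛ≤1 s a)
  ... | no  _         = ≤-refl

  -- A minimiser of `dₛ s` on `A` serves as witness: its distance is a lower bound of the image,
  -- hence at most the infimum. For empty `A` the default distance 1 would contradict `¬ (1# ≤ r)`.
  dₚ≤⇒close : ∀ {n} → E ↔ Fin n → ∀ {r} → ¬ (1# ≤ r) → ∀ s A →
              dₚ s A ≤ r → ∃[ a ] a ∈ A × dₛ s a ≤ r
  dₚ≤⇒close E↔Fin 1≰r s A d≤r with em₀ {P = Satisfiable A}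
  ... | no  _        = contradiction d≤r 1≰r
  ... | yes nonempty with dₛ-hasMinimum E↔Fin s A nonempty
  ...   | a , a∈A , a-min = a , a∈A , ≤-trans
    (inf-greatest (dₛ s a , a , a∈A , Eq.refl)
      (λ (_ , b∈A , x≈d) → ≤-trans (a-min b∈A) (≤-reflexive (Eq.sym x≈d))))
    d≤r

  -- All distances to `A′` are bounded by 1, so the supremum is a genuine one and not the default.
  dₚ≤sup : ∀ A A′ {a} → a ∈ A → dₚ a A′ ≤ sup (image (λ b → dₚ b A′) A)
  dₚ≤sup A A′ {a} a∈A = sup-upper {u = 1#}
    (λ (b , _ , x≈d) → ≤-trans (≤-reflexive x≈d) (dₚ≤1 b A′))
    (a , a∈A , Eq.refl)

  dₚ≤dₕˡ : ∀ A A′ {a} → a ∈ A → dₚ a A′ ≤ dₕ A A′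
  dₚ≤dₕˡ A A′ a∈A = ≤-trans (dₚ≤sup A A′ a∈A) (x≤x⊔y _ _)

  dₚ≤dₕʳ : ∀ A A′ {a} → a ∈ A′ → dₚ a A ≤ dₕ A A′
  dₚ≤dₕʳ A A′ a∈A′ = ≤-trans (dₚ≤sup A′ A a∈A′) (x≤y⊔x _ _)

  dₕ-least : ∀ {A A′ r} → 0# ≤ r → (∀ {a} → a ∈ A → dₚ a A′ ≤ r) →
             (∀ {a} → a ∈ A′ → dₚ a A ≤ r) → dₕ A A′ ≤ r
  dₕ-least 0≤r A≤ A′≤ = ⊔-lub
    (sup-least 0≤r (λ (_ , a∈A  , x≈d) → ≤-trans (≤-reflexive x≈d) (A≤ a∈A)))
    (sup-least 0≤r (λ (_ , a∈A′ , x≈d) → ≤-trans (≤-reflexive x≈d) (A′≤ a∈A′)))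

-- The supremal controllable sublanguage.

module Supremal (em : ExcludedMiddle (lsuc 0ℓ)) {E : Set}
                (Euc : Pred E 0ℓ) (G : Automaton E) where
  open Classical em

  supremal-⊆ : ∀ K → supremal Euc G K ⊆ K
  supremal-⊆ K s∈ with toWitness s∈
  ... | _ , _ , M⊆K , s∈M = M⊆K s∈M

  supremal-greatest : ∀ {K M} → Controllable Euc G M → M ⊆ K → M ⊆ supremal Euc G K
  supremal-greatest {K} {M} M-ctrl M⊆K {s} s∈M =
    fromWitness {a? = em {P = ∃[ M ] Controllable Euc G M × M ⊆ K × s ∈ M}}
      (M , M-ctrl , M⊆K , s∈M)

  -- A prefix in the closure of the union extends to a member of a single controllable `M`;
  -- controllability of that `M` supplies the extension of the longer prefix, again inside the
  -- union.
  supremal-controllable : ∀ K → Controllable Euc G (supremal Euc G K)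
  supremal-controllable K = record
    { K⊆L    = λ s∈ → let _ , M-ctrl , _ , s∈M = toWitness s∈ in
                      Controllable.K⊆L M-ctrl s∈M
    ; closed = λ (t , st∈) a∈Euc sa∈L →
        let _ , M-ctrl , M⊆K , st∈M = toWitness st∈
            u , sau∈M = Controllable.closed M-ctrl (t , st∈M) a∈Euc sa∈L
        in u , supremal-greatest M-ctrl M⊆K sau∈M
    }

-- Realizations compared with the supremal controllable part of the ball.

theorem1 : (em : ExcludedMiddle (lsuc 0ℓ)) (ℝ : CompleteOrderedField) →
    let open CompleteOrderedField ℝ
        open Classical em
    in
    (E : Set) (n : ℕ) → E ↔ Fin n →
    (Euc : Pred E 0ℓ) (G : Automaton E) (metric : UnitMetric ℝ E) →
    let open Distance ℝ metric in
    (r : Carrier) → 0# ≤ r → r ≤ 1# →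
    (K : Language E) → K ⊆ L G →
    λ-Controllable Euc G r K ⇔ dₕ (supremal Euc G (B G K r)) K ≤ r
theorem1 em ℝ E n E↔Fin Euc G metric r 0≤r r≤1 K K⊆L =
  -- For the converse, `K↑` is itself a realization.
  mk⇔ necessary (λ d≤r → K↑ , supremal-controllable (B G K r) , d≤r)
  where
  open CompleteOrderedField ℝ
  open Classical em
  open Distance ℝ metric
  open OrderedField ℝ using (≤-trans; ≤-reflexive)
  open Distances em ℝ metric
  open Supremal em Euc G

  K↑ : Language E
  K↑ = supremal Euc G (B G K r)

  necessary : λ-Controllable Euc G r K → dₕ K↑ K ≤ r
  necessary (K̃ , K̃-ctrl , d≤r) with em₀ {P = 1# ≤ r}
  ... | yes 1≤r = dₕ-least 0≤r
    (λ {s} _ → ≤-trans (dₚ≤1 s K) 1≤r) (λ {s} _ → ≤-trans (dₚ≤1 s K↑) 1≤r)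
  ... | no 1≰r = dₕ-least 0≤r K↑-close K-close
    where
    K̃⊆B : K̃ ⊆ B G K r
    K̃⊆B {t} t∈K̃
      -- A nearest point `s` of `K` is the centre of a ball containing `t`; symmetry turns the
      -- distance round.
      with dₚ≤⇒close E↔Fin 1≰r t K (≤-trans (dₚ≤dₕˡ K̃ K t∈K̃) d≤r)
    ... | s , s∈K , dts≤r =
      s , s∈K , Controllable.K⊆L K̃-ctrl t∈K̃ , ≤-trans (≤-reflexive (dₛ-sym s t)) dts≤r

    K↑-close : ∀ {t} → t ∈ K↑ → dₚ t K ≤ r
    K↑-close {t} t∈K↑ with supremal-⊆ (B G K r) t∈K↑
    ... | s , s∈K , _ , dst≤r =
      ≤-trans (dₚ≤dₛ t s∈K) (≤-trans (≤-reflexive (dₛ-sym t s)) dst≤r)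

    K-close : ∀ {s} → s ∈ K → dₚ s K↑ ≤ r
    K-close {s} s∈K
      with dₚ≤⇒close E↔Fin 1≰r s K̃ (≤-trans (dₚ≤dₕʳ K̃ K s∈K) d≤r)
    ... | t , t∈K̃ , dst≤r =
      -- The point `t` of the realization near `s` lies in `K↑` by maximality.
      ≤-trans (dₚ≤dₛ s (supremal-greatest K̃-ctrl K̃⊆B t∈K̃)) dst≤r
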